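{- If $\Gamma\vdash M:A\mid\Sigma$ is derivable in $\lambda\mu$, then ${?}\Gamma^{\mathsf T},(\Sigma^{\mathsf T})^\perp,k:(A^{\mathsf T})^\perp;\cdot\vdash M^{\mathsf T}_k:\bot$ is derivable in $\lambda_{\mathrm{MELL}}$, for $k$ a fresh unrestricted variable. Here ${?}\Gamma^{\mathsf T}$ assigns ${?}(B^{\mathsf T})$ to $x$ for each $x:B$ in $\Gamma$, $(\Sigma^{\mathsf T})^\perp$ assigns $(B^{\mathsf T})^\perp$ to $\gamma$ for each $\gamma:B$ in $\Sigma$, and the linear environment is empty.
   Context: The $\lambda\mu$-calculus. Types: $A,B::=\bot\mid\alpha\mid A\supset B$ ($\alpha$ atomic). Terms: $M,N::=x\mid\lambda x.M\mid M\,N\mid[\gamma]M\mid\mu\gamma.M$, where $x$ ranges over variables and $\gamma,\delta$ over continuation variables. Judgements $\Gamma\vdash M:A\mid\Sigma$, with $\Gamma$ (resp. $\Sigma$) a partial function from variables (resp. continuation variables) to types. Rules (premises $\Rightarrow$ conclusion): $\Rightarrow\Gamma,x:A\vdash x:A\mid\Sigma$; $\Gamma,x:A\vdash M:B\mid\Sigma$ $\Rightarrow$ $\Gamma\vdash\lambda x.M:A\supset B\mid\Sigma$; $\Gamma\vdash M:A\supset B\mid\Sigma$ and $\Gamma\vdash N:A\mid\Sigma$ $\Rightarrow$ $\Gamma\vdash M\,N:B\mid\Sigma$; $\Gamma\vdash M:A\mid\Sigma,\gamma:A$ $\Rightarrow$ $\Gamma\vdash[\gamma]M:\bot\mid\Sigma,\gamma:A$;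 $\Gamma\vdash M:\bot\mid\Sigma,\gamma:A$ $\Rightarrow$ $\Gamma\vdash\mu\gamma.M:A\mid\Sigma$. MELL formulae: $A,B::=\alpha\mid\overline\alpha\mid A\otimes B\mid A\wp B\mid\mathbf 1\mid\bot\mid{!}A\mid{?}A$ ($\wp$ is "par"). Linear negation is the involution $\alpha^\perp=\overline\alpha$, $\overline\alpha^\perp=\alpha$, $(A\otimes B)^\perp=A^\perp\wp B^\perp$, $(A\wp B)^\perp=A^\perp\otimes B^\perp$, $\mathbf1^\perp=\bot$, $\bot^\perp=\mathbf1$, $({!}A)^\perp={?}(A^\perp)$, $({?}A)^\perp={!}(A^\perp)$. Terms of $\lambda_{\mathrm{MELL}}$, over linear variables $a,b,c,\dots$ and unrestricted variables $u,v,\dots$: $t,s::=a\mid u\mid\langle t,s\rangle\mid t[\langle a,b\rangle:=s]\mid\wp(a,b).t\mid t\bullet s\mid t\blacktriangledown s\mid{!}a.t\mid t[{!}u:=s]\mid{?}u.t\mid t\blacktriangleright^{a}s\mid t\,\sharp\,s\mid\star\mid t[\star:=s]$. Binding: $t[\langle a,b\rangle:=s]$ and $\wp(a,b).t$ bind $a,b$ in $t$; ${!}a.t$ and $t\blacktriangleright^a s$ bind $a$ in $t$; $t[{!}u:=s]$ and ${?}u.t$ bind $u$ in $t$. Terms are taken up to $\alpha$-renaming. $t\{a:=s\}$ and $t\{u:=s\}$ denote capture-avoiding substitution. Typing judgements $\Delta;\Gamma\vdash t:A$, where $\Delta$ (resp. $\Gamma$) is a finite partial function from unrestricted (resp. linear)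 variables to formulae; $\Gamma,\Gamma'$ denotes union with disjoint domains. Typing rules: $\Rightarrow\Delta;a:A\vdash a:A$; $\Rightarrow\Delta,u:A;\cdot\vdash u:A$; $\Delta;\Gamma\vdash t:A$ and $\Delta;\Gamma'\vdash s:B$ $\Rightarrow$ $\Delta;\Gamma,\Gamma'\vdash\langle t,s\rangle:A\otimes B$; $\Delta;\Gamma\vdash s:A\otimes B$ and $\Delta;\Gamma',a:A,b:B\vdash t:C$ $\Rightarrow$ $\Delta;\Gamma,\Gamma'\vdash t[\langle a,b\rangle:=s]:C$; $\Delta;\Gamma,a:A,b:B\vdash t:\bot$ $\Rightarrow$ $\Delta;\Gamma\vdash\wp(a,b).t:A^\perp\wp B^\perp$; $\Delta;\Gamma\vdash t:A\wp B$ and $\Delta;\Gamma'\vdash s:A^\perp$ $\Rightarrow$ $\Delta;\Gamma,\Gamma'\vdash t\bullet s:B$; $\Delta;\Gamma\vdash t:A\wp B$ and $\Delta;\Gamma'\vdash s:B^\perp$ $\Rightarrow$ $\Delta;\Gamma,\Gamma'\vdash t\blacktriangledown s:A$; $\Delta;a:A\vdash t:\bot$ $\Rightarrow$ $\Delta;\cdot\vdash{!}a.t:{!}(A^\perp)$; $\Delta;\Gamma\vdash s:{!}A$ and $\Delta,u:A;\Gamma'\vdash t:B$ $\Rightarrow$ $\Delta;\Gamma,\Gamma'\vdash t[{!}u:=s]:B$; $\Delta,u:A^\perp;\Gamma\vdash t:\bot$ $\Rightarrow$ $\Delta;\Gamma\vdash{?}u.t:{?}A$; $\Delta;\Gamma\vdash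 s:{?}A$ and $\Delta;a:A\vdash t:\bot$ $\Rightarrow$ $\Delta;\Gamma\vdash t\blacktriangleright^a s:\bot$; $\Delta;\Gamma\vdash t:B$ and $\Delta;\Gamma'\vdash s:B^\perp$ $\Rightarrow$ $\Delta;\Gamma,\Gamma'\vdash t\,\sharp\,s:\bot$; $\Rightarrow\Delta;\cdot\vdash\star:\mathbf1$; $\Delta;\Gamma\vdash s:\mathbf1$ and $\Delta;\Gamma'\vdash t:A$ $\Rightarrow$ $\Delta;\Gamma,\Gamma'\vdash t[\star:=s]:A$. T-translation. Write ${!}t:={!}a.(t\,\sharp\,a)$ with $a$ fresh. On types: $\bot^{\mathsf T}=\bot$, $\alpha^{\mathsf T}=\alpha$, $(A\supset B)^{\mathsf T}={?}{!}(A^{\mathsf T})^\perp\wp{?}B^{\mathsf T}$. Variables and continuation variables of $\lambda\mu$ are regarded as unrestricted variables. On terms, relative to an unrestricted variable $k$ (with $k',k'',a,b$ fresh): $x^{\mathsf T}_k=x\,\sharp\,{!}k$; $(\lambda x.M)^{\mathsf T}_k=(\wp(a,b).M^{\mathsf T}_{k'}[{!}x:=a][{!}k':=b])\,\sharp\,k$; $(M\,N)^{\mathsf T}_k=M^{\mathsf T}_{k'}\{k':=\langle{!}({?}k''.N^{\mathsf T}_{k''}),{!}k\rangle\}$; $([\gamma]M)^{\mathsf T}_k=(M^{\mathsf T}_{k'}\{k':=\gamma\})\,\sharp\,k$; $(\mu\gamma.M)^{\mathsf T}_k=M^{\mathsf T}_{k'}\{k':=\star\}\{\gamma:=k\}$.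 -}

module Defs where

open import Data.Nat.Base using (ℕ; suc; _+_)
open import Data.Fin.Base using (Fin; zero; suc; lift; _↑ˡ_; _↑ʳ_)
open import Data.Maybe.Base using (Maybe; just; nothing)
open import Data.Vec.Base using (Vec; []; _∷_; lookup; replicate; map; _++_; _[_]≔_)
open import Function.Base using (_∘_; id)
open import Relation.Binary.PropositionalEquality using (_≡_)

-- Terms are well-scoped de Bruijn terms, so that syntactic equality is equality
-- up to renaming of bound variables.  Whenever two variables are bound at once,
-- the one written last is the most recent one (index 0).

Atom : Set
Atom = ℕ

------------------------------------------------------------------------
-- The λμ-calculus

infixr 6 _⊃_

data Type : Set where
  ⊥   : Type
  at  : Atom → Type
  _⊃_ : Type → Type → Type

-- Tm n m: n variables and m continuation variables in scope.  Environments of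
-- variables and of continuation variables have exactly the scope as their domain;
-- so do unrestricted environments of λ_MELL below.

infixl 7 _·_

data Tm (n m : ℕ) : Set where
  var   : Fin n → Tm n m
  ƛ_    : Tm (suc n) m → Tm n m
  _·_   : Tm n m → Tm n m → Tm n m
  named : Fin m → Tm n m → Tm n m
  μ_    : Tm n (suc m) → Tm n m

infix 3 _⊢_∶_∣_

data _⊢_∶_∣_ {n m} (Γ : Vec Type n) : Tm n m → Type → Vec Type m → Set where
  ⊢var   : ∀ {Σ x A} → lookup Γ x ≡ A →
           Γ ⊢ var x ∶ A ∣ Σ
  ⊢ƛ     : ∀ {Σ M A B} → A ∷ Γ ⊢ M ∶ B ∣ Σ →
           Γ ⊢ ƛ M ∶ A ⊃ B ∣ Σ
  ⊢·     : ∀ {Σ M N A B} → Γ ⊢ M ∶ A ⊃ B ∣ Σ → Γ ⊢ N ∶ A ∣ Σ →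
           Γ ⊢ M · N ∶ B ∣ Σ
  ⊢named : ∀ {Σ γ M A} → lookup Σ γ ≡ A → Γ ⊢ M ∶ A ∣ Σ →
           Γ ⊢ named γ M ∶ ⊥ ∣ Σ
  ⊢μ     : ∀ {Σ M A} → Γ ⊢ M ∶ ⊥ ∣ A ∷ Σ →
           Γ ⊢ μ M ∶ A ∣ Σ

------------------------------------------------------------------------
-- MELL formulae

-- ⁇ is the exponential "why not"; a plain question mark cannot occur in Agda names.

infixr 7 _⊗_
infixr 6 _⅋_
infix  9 !_ ⁇_
infix  10 _^⊥

data Formula : Set where
  at at⊥  : Atom → Formula
  _⊗_ _⅋_ : Formula → Formula → Formula
  𝟙 ⊥     : Formula
  !_ ⁇_   : Formula → Formula

_^⊥ : Formula → Formula
at α    ^⊥ = at⊥ α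
at⊥ α   ^⊥ = at α
(A ⊗ B) ^⊥ = A ^⊥ ⅋ B ^⊥
(A ⅋ B) ^⊥ = A ^⊥ ⊗ B ^⊥
𝟙       ^⊥ = ⊥
⊥       ^⊥ = 𝟙
(! A)   ^⊥ = ⁇ (A ^⊥)
(⁇ A)   ^⊥ = ! (A ^⊥)

------------------------------------------------------------------------
-- Terms of λ_MELL

-- Term l u: l linear and u unrestricted variables in scope.  Being in scope is
-- not being available: linearity is enforced by typing only.  A term constructor
-- with subscript ₗ or ᵤ binds a linear or an unrestricted variable.

infix 8 _[⟨,⟩:=_] _[!:=_] _[⋆:=_]
infix 7 _•_ _▼_ _▶_ _♯_
infix 9 ⅋ₗ_ !ₗ_ ⁇ᵤ_

data Term (l u : ℕ) : Set where
  lvar     : Fin l → Term l u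
  uvar     : Fin u → Term l u
  ⟨_,_⟩    : Term l u → Term l u → Term l u
  _[⟨,⟩:=_] : Term (2 + l) u → Term l u → Term l u
  ⅋ₗ_      : Term (2 + l) u → Term l u
  _•_      : Term l u → Term l u → Term l u
  _▼_      : Term l u → Term l u → Term l u
  !ₗ_      : Term (suc l) u → Term l u
  _[!:=_]  : Term l (suc u) → Term l u → Term l u
  ⁇ᵤ_      : Term l (suc u) → Term l u
  _▶_      : Term (suc l) u → Term l u → Term l u
  _♯_      : Term l u → Term l u → Term l u
  ⋆        : Term l u
  _[⋆:=_]  : Term l u → Term l u → Term l u

ren : ∀ {l l′ u u′} → (Fin l → Fin l′) → (Fin u → Fin u′) → Term l u → Term l′ u′
ren ξ ζ (lvar a)       = lvar (ξ a)
ren ξ ζ (uvar x)       = uvar (ζ x)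
ren ξ ζ ⟨ t , s ⟩      = ⟨ ren ξ ζ t , ren ξ ζ s ⟩
ren ξ ζ (t [⟨,⟩:= s ]) = ren (lift 2 ξ) ζ t [⟨,⟩:= ren ξ ζ s ]
ren ξ ζ (⅋ₗ t)         = ⅋ₗ ren (lift 2 ξ) ζ t
ren ξ ζ (t • s)        = ren ξ ζ t • ren ξ ζ s
ren ξ ζ (t ▼ s)        = ren ξ ζ t ▼ ren ξ ζ s
ren ξ ζ (!ₗ t)         = !ₗ ren (lift 1 ξ) ζ t
ren ξ ζ (t [!:= s ])   = ren ξ (lift 1 ζ) t [!:= ren ξ ζ s ]
ren ξ ζ (⁇ᵤ t)         = ⁇ᵤ ren ξ (lift 1 ζ) t
ren ξ ζ (t ▶ s)        = ren (lift 1 ξ) ζ t ▶ ren ξ ζ s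
ren ξ ζ (t ♯ s)        = ren ξ ζ t ♯ ren ξ ζ s
ren ξ ζ ⋆              = ⋆
ren ξ ζ (t [⋆:= s ])   = ren ξ ζ t [⋆:= ren ξ ζ s ]

-- Simultaneous substitution for the unrestricted variables.

Subst : ℕ → ℕ → ℕ → Set
Subst l u u′ = Fin u → Term l u′

wkₗ : ∀ {l u u′} k → Subst l u u′ → Subst (k + l) u u′
wkₗ k σ = ren (k ↑ʳ_) id ∘ σ

liftᵤ : ∀ {l u u′} → Subst l u u′ → Subst l (suc u) (suc u′)
liftᵤ σ zero    = uvar zero
liftᵤ σ (suc x) = ren id suc (σ x)

sub : ∀ {l u u′} → Subst l u u′ → Term l u → Term l u′
sub σ (lvar a)       = lvar a
sub σ (uvar x)       = σ x
sub σ ⟨ t , s ⟩      = ⟨ sub σ t , sub σ s ⟩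
sub σ (t [⟨,⟩:= s ]) = sub (wkₗ 2 σ) t [⟨,⟩:= sub σ s ]
sub σ (⅋ₗ t)         = ⅋ₗ sub (wkₗ 2 σ) t
sub σ (t • s)        = sub σ t • sub σ s
sub σ (t ▼ s)        = sub σ t ▼ sub σ s
sub σ (!ₗ t)         = !ₗ sub (wkₗ 1 σ) t
sub σ (t [!:= s ])   = sub (liftᵤ σ) t [!:= sub σ s ]
sub σ (⁇ᵤ t)         = ⁇ᵤ sub (liftᵤ σ) t
sub σ (t ▶ s)        = sub (wkₗ 1 σ) t ▶ sub σ s
sub σ (t ♯ s)        = sub σ t ♯ sub σ s
sub σ ⋆              = ⋆
sub σ (t [⋆:= s ])   = sub σ t [⋆:= sub σ s ]

-- t { s } is t{u:=s} for u the most recent unrestricted variable.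

infix 10 _｛_｝

_｛_｝ : ∀ {l u} → Term l (suc u) → Term l u → Term l u
t ｛ s ｝ = sub (λ { zero → s ; (suc x) → uvar x }) t

------------------------------------------------------------------------
-- Typing of λ_MELL

-- Linear environments are partial functions on the linear variables in scope.

LEnv : ℕ → Set
LEnv l = Vec (Maybe Formula) l

∅ : ∀ {l} → LEnv l
∅ = replicate _ nothing

_↦_ : ∀ {l} → Fin l → Formula → LEnv l
a ↦ A = ∅ [ a ]≔ just A

-- Γ₁ , Γ₂ ≔ Γ: the domains of Γ₁ and Γ₂ are disjoint and Γ is their union.

infix 4 _,_≔_

data _,_≔_ : ∀ {l} → LEnv l → LEnv l → LEnv l → Set where
  []    : [] , [] ≔ []
  none  : ∀ {l} {Γ₁ Γ₂ Γ : LEnv l} → Γ₁ , Γ₂ ≔ Γ →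
          nothing ∷ Γ₁ , nothing ∷ Γ₂ ≔ nothing ∷ Γ
  left  : ∀ {l A} {Γ₁ Γ₂ Γ : LEnv l} → Γ₁ , Γ₂ ≔ Γ →
          just A ∷ Γ₁ , nothing ∷ Γ₂ ≔ just A ∷ Γ
  right : ∀ {l A} {Γ₁ Γ₂ Γ : LEnv l} → Γ₁ , Γ₂ ≔ Γ →
          nothing ∷ Γ₁ , just A ∷ Γ₂ ≔ just A ∷ Γ

infix 3 _⨾_⊢_∶_

data _⨾_⊢_∶_ {l u} (Δ : Vec Formula u) : LEnv l → Term l u → Formula → Set where
  ⊢lvar : ∀ {a A} →
          Δ ⨾ a ↦ A ⊢ lvar a ∶ A
  ⊢uvar : ∀ {x A} → lookup Δ x ≡ A →
          Δ ⨾ ∅ ⊢ uvar x ∶ A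
  ⊢⊗    : ∀ {Γ Γ₁ Γ₂ t s A B} → Γ₁ , Γ₂ ≔ Γ →
          Δ ⨾ Γ₁ ⊢ t ∶ A → Δ ⨾ Γ₂ ⊢ s ∶ B →
          Δ ⨾ Γ ⊢ ⟨ t , s ⟩ ∶ A ⊗ B
  ⊢let⊗ : ∀ {Γ Γ₁ Γ₂ t s A B C} → Γ₁ , Γ₂ ≔ Γ →
          Δ ⨾ Γ₁ ⊢ s ∶ A ⊗ B → Δ ⨾ just B ∷ just A ∷ Γ₂ ⊢ t ∶ C →
          Δ ⨾ Γ ⊢ t [⟨,⟩:= s ] ∶ C
  ⊢⅋    : ∀ {Γ t A B} →
          Δ ⨾ just B ∷ just A ∷ Γ ⊢ t ∶ ⊥ →
          Δ ⨾ Γ ⊢ ⅋ₗ t ∶ A ^⊥ ⅋ B ^⊥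
  ⊢•    : ∀ {Γ Γ₁ Γ₂ t s A B} → Γ₁ , Γ₂ ≔ Γ →
          Δ ⨾ Γ₁ ⊢ t ∶ A ⅋ B → Δ ⨾ Γ₂ ⊢ s ∶ A ^⊥ →
          Δ ⨾ Γ ⊢ t • s ∶ B
  ⊢▼    : ∀ {Γ Γ₁ Γ₂ t s A B} → Γ₁ , Γ₂ ≔ Γ →
          Δ ⨾ Γ₁ ⊢ t ∶ A ⅋ B → Δ ⨾ Γ₂ ⊢ s ∶ B ^⊥ →
          Δ ⨾ Γ ⊢ t ▼ s ∶ A
  ⊢!    : ∀ {t A} →
          Δ ⨾ just A ∷ ∅ ⊢ t ∶ ⊥ →
          Δ ⨾ ∅ ⊢ !ₗ t ∶ ! (A ^⊥)
  ⊢let! : ∀ {Γ Γ₁ Γ₂ t s A B} → Γ₁ , Γ₂ ≔ Γ →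
          Δ ⨾ Γ₁ ⊢ s ∶ ! A → A ∷ Δ ⨾ Γ₂ ⊢ t ∶ B →
          Δ ⨾ Γ ⊢ t [!:= s ] ∶ B
  ⊢⁇    : ∀ {Γ t A} →
          A ^⊥ ∷ Δ ⨾ Γ ⊢ t ∶ ⊥ →
          Δ ⨾ Γ ⊢ ⁇ᵤ t ∶ ⁇ A
  ⊢▶    : ∀ {Γ t s A} →
          Δ ⨾ Γ ⊢ s ∶ ⁇ A → Δ ⨾ just A ∷ ∅ ⊢ t ∶ ⊥ →
          Δ ⨾ Γ ⊢ t ▶ s ∶ ⊥
  ⊢♯    : ∀ {Γ Γ₁ Γ₂ t s B} → Γ₁ , Γ₂ ≔ Γ →
          Δ ⨾ Γ₁ ⊢ t ∶ B → Δ ⨾ Γ₂ ⊢ s ∶ B ^⊥ →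
          Δ ⨾ Γ ⊢ t ♯ s ∶ ⊥
  ⊢⋆    : Δ ⨾ ∅ ⊢ ⋆ ∶ 𝟙
  ⊢let⋆ : ∀ {Γ Γ₁ Γ₂ t s A} → Γ₁ , Γ₂ ≔ Γ →
          Δ ⨾ Γ₁ ⊢ s ∶ 𝟙 → Δ ⨾ Γ₂ ⊢ t ∶ A →
          Δ ⨾ Γ ⊢ t [⋆:= s ] ∶ A

------------------------------------------------------------------------
-- The T-translation

infix 11 _ᵀ

_ᵀ : Type → Formula
⊥ ᵀ       = ⊥
at α ᵀ    = at α
(A ⊃ B) ᵀ = ⁇ (! (A ᵀ ^⊥)) ⅋ ⁇ (B ᵀ)

-- The term !t = !a.(t ♯ a).

bang : ∀ {l u} → Term l u → Term l u
bang t = !ₗ (ren suc id t ♯ lvar zero)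

-- ⟦ M ⟧ ρ κ k is M^T_k, where ρ and κ say which unrestricted variables the
-- variables and the continuation variables of M are regarded as.

⟦_⟧ : ∀ {n m l u} → Tm n m → (Fin n → Fin u) → (Fin m → Fin u) → Fin u → Term l u
⟦ var x ⟧     ρ κ k = uvar (ρ x) ♯ bang (uvar k)
⟦ ƛ M ⟧       ρ κ k = ⅋ₗ (M′ [!:= lvar a ] [!:= lvar b ]) ♯ uvar k
  where
  a = suc zero
  b = zero
  -- Here x is unrestricted variable 0 and k′ is 1.
  M′ = ⟦ M ⟧ (lift 1 (suc ∘ ρ)) ((2 ↑ʳ_) ∘ κ) (suc zero)
⟦ M · N ⟧     ρ κ k =
  ⟦ M ⟧ (suc ∘ ρ) (suc ∘ κ) zero
    ｛ ⟨ bang (⁇ᵤ ⟦ N ⟧ (suc ∘ ρ) (suc ∘ κ) zero) , bang (uvar k) ⟩ ｝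
⟦ named γ M ⟧ ρ κ k = ⟦ M ⟧ (suc ∘ ρ) (suc ∘ κ) zero ｛ uvar (κ γ) ｝ ♯ uvar k
⟦ μ M ⟧       ρ κ k = M′ ｛ ⋆ ｝ ｛ uvar k ｝
  where
  -- Here k′ is unrestricted variable 0 and γ is 1.
  M′ = ⟦ M ⟧ ((2 ↑ʳ_) ∘ ρ) (suc ∘ lift 1 κ) zero

-- M^T_k for k fresh.  Unrestricted variables: k, then the variables of M, then
-- its continuation variables.

translate : ∀ {n m l} → Tm n m → Term l (suc (n + m))
translate {n} {m} M = ⟦ M ⟧ (λ x → suc (x ↑ˡ m)) (λ γ → suc (n ↑ʳ γ)) zero

⁇_ᵀ* : ∀ {n} → Vec Type n → Vec Formula n
⁇ Γ ᵀ* = map (λ B → ⁇ (B ᵀ)) Γ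

_ᵀ*^⊥ : ∀ {m} → Vec Type m → Vec Formula m
Σ ᵀ*^⊥ = map (λ B → B ᵀ ^⊥) Σ

{-# OPTIONS --safe #-}

-- Every term substituted by the translation is typed in the empty linear
-- environment, so λ_MELL only needs substitution for unrestricted variables by
-- linearly closed terms; the lemma then follows by induction on the λμ-derivation.

module Submission where

open import Defs
open import Data.Nat.Base using (ℕ; zero; suc)
open import Data.Vec.Base using (Vec; _∷_; _++_; lookup)
open import Data.Fin.Base using (Fin; zero; suc; lift)
open import Data.Product.Base using (∃₂; _×_; _,_)
open import Data.Vec.Properties using (∷-injectiveʳ; lookup-map; lookup-++ˡ; lookup-++ʳ)
open import Function.Base using (_∘_; id)
open import Relation.Binary.PropositionalEquality
  using (_≡_; _≢_; _≗_; refl; sym; trans; cong; cong₂)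
open import Relation.Nullary.Negation using (contradiction)

^⊥-involutive : ∀ A → A ^⊥ ^⊥ ≡ A
^⊥-involutive (at α)  = refl
^⊥-involutive (at⊥ α) = refl
^⊥-involutive (A ⊗ B) = cong₂ _⊗_ (^⊥-involutive A) (^⊥-involutive B)
^⊥-involutive (A ⅋ B) = cong₂ _⅋_ (^⊥-involutive A) (^⊥-involutive B)
^⊥-involutive 𝟙       = refl
^⊥-involutive ⊥       = refl
^⊥-involutive (! A)   = cong !_ (^⊥-involutive A)
^⊥-involutive (⁇ A)   = cong ⁇_ (^⊥-involutive A)

⊢-resp-≡ : ∀ {l u} {Δ : Vec Formula u} {Γ : LEnv l} {t A B} →
           A ≡ B → Δ ⨾ Γ ⊢ t ∶ A → Δ ⨾ Γ ⊢ t ∶ B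
⊢-resp-≡ refl t = t

∅-split : ∀ {l} → ∅ {l} , ∅ ≔ ∅
∅-split {zero}  = []
∅-split {suc l} = none ∅-split

∅-split⁻¹ : ∀ {l} {Γ₁ Γ₂ : LEnv l} → Γ₁ , Γ₂ ≔ ∅ → Γ₁ ≡ ∅ × Γ₂ ≡ ∅
∅-split⁻¹ {zero}  []       = refl , refl
∅-split⁻¹ {suc l} (none p) with refl , refl ← ∅-split⁻¹ p = refl , refl

-- Linear renamings carrying Γ to its image.  Only renamings of linearly closed
-- terms occur, so ξ may be arbitrary outside the binders passed so far.  Asking
-- for lift 1 ξ only pointwise lets extend apply to lift 2 ξ as well.

infix 4 _∶_↪_

data _∶_↪_ : ∀ {l l′} → (Fin l → Fin l′) → LEnv l → LEnv l′ → Set where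
  closed : ∀ {l l′} {ξ : Fin l → Fin l′} {Γ} → Γ ≡ ∅ → ξ ∶ Γ ↪ ∅
  extend : ∀ {l l′ m Γ Γ′} {ξ : Fin l → Fin l′} {ξ′} →
           ξ ∶ Γ ↪ Γ′ → ξ′ ≗ lift 1 ξ → ξ′ ∶ m ∷ Γ ↪ m ∷ Γ′

lift₁ : ∀ {l l′ m Γ Γ′} {ξ : Fin l → Fin l′} →
        ξ ∶ Γ ↪ Γ′ → lift 1 ξ ∶ m ∷ Γ ↪ m ∷ Γ′
lift₁ r = extend r (λ _ → refl)

lift₂ : ∀ {l l′ m m′ Γ Γ′} {ξ : Fin l → Fin l′} →
        ξ ∶ Γ ↪ Γ′ → lift 2 ξ ∶ m ∷ m′ ∷ Γ ↪ m ∷ m′ ∷ Γ′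
lift₂ r = extend (lift₁ r) λ { zero → refl ; (suc _) → refl }

↦≢∅ : ∀ {l A} (a : Fin l) → a ↦ A ≢ ∅
↦≢∅ (suc a) e = ↦≢∅ a (∷-injectiveʳ e)

↪-∅ : ∀ {l l′ Γ′} {ξ : Fin l → Fin l′} → ξ ∶ ∅ ↪ Γ′ → Γ′ ≡ ∅
↪-∅ (closed _)           = refl
↪-∅ {suc l} (extend r _) with refl ← ↪-∅ r = refl

↪-↦ : ∀ {l l′ A Γ′} {ξ : Fin l → Fin l′} a → ξ ∶ a ↦ A ↪ Γ′ → Γ′ ≡ ξ a ↦ A
↪-↦ zero    (extend r e) rewrite e zero | ↪-∅ r = refl
↪-↦ (suc a) (extend r e) rewrite e (suc a) | ↪-↦ a r = refl
-- `closed` forces an empty source, which a singleton is not.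
↪-↦ a       (closed e) = contradiction e (↦≢∅ a)

-- The image splits along the source; an empty environment has only empty halves, so `closed` serves
-- for both.
↪-split : ∀ {l l′ Γ Γ₁ Γ₂ Γ′} {ξ : Fin l → Fin l′} →
          Γ₁ , Γ₂ ≔ Γ → ξ ∶ Γ ↪ Γ′ →
          ∃₂ λ Γ₁′ Γ₂′ → ξ ∶ Γ₁ ↪ Γ₁′ × ξ ∶ Γ₂ ↪ Γ₂′ × Γ₁′ , Γ₂′ ≔ Γ′
↪-split p (closed refl) with refl , refl ← ∅-split⁻¹ p =
  _ , _ , closed refl , closed refl , ∅-split
↪-split (none p)  (extend r e) with _ , _ , r₁ , r₂ , q ← ↪-split p r =
  _ , _ , extend r₁ e , extend r₂ e , none q
↪-split (left p)  (extend r e) with _ , _ , r₁ , r₂ , q ← ↪-split p r =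
  _ , _ , extend r₁ e , extend r₂ e , left q
↪-split (right p) (extend r e) with _ , _ , r₁ , r₂ , q ← ↪-split p r =
  _ , _ , extend r₁ e , extend r₂ e , right q

lookup-lift : ∀ {u u′ A} {Δ : Vec Formula u} {Δ′ : Vec Formula u′} {ζ : Fin u → Fin u′} →
              lookup Δ′ ∘ ζ ≗ lookup Δ →
              lookup (A ∷ Δ′) ∘ lift 1 ζ ≗ lookup (A ∷ Δ)
lookup-lift h zero    = refl
lookup-lift h (suc x) = h x

⊢ren : ∀ {l l′ u u′ Δ Δ′ Γ Γ′ A t} {ξ : Fin l → Fin l′} {ζ : Fin u → Fin u′} →
       ξ ∶ Γ ↪ Γ′ → lookup Δ′ ∘ ζ ≗ lookup Δ →
       Δ ⨾ Γ ⊢ t ∶ A → Δ′ ⨾ Γ′ ⊢ ren ξ ζ t ∶ A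
⊢ren r h (⊢lvar {a}) rewrite ↪-↦ a r = ⊢lvar
⊢ren r h (⊢uvar e) rewrite ↪-∅ r = ⊢uvar (trans (h _) e)
⊢ren r h (⊢⊗ p t s) with _ , _ , r₁ , r₂ , q ← ↪-split p r =
  ⊢⊗ q (⊢ren r₁ h t) (⊢ren r₂ h s)
⊢ren r h (⊢let⊗ p s t) with _ , _ , r₁ , r₂ , q ← ↪-split p r =
  ⊢let⊗ q (⊢ren r₁ h s) (⊢ren (lift₂ r₂) h t)
⊢ren r h (⊢⅋ t) = ⊢⅋ (⊢ren (lift₂ r) h t)
⊢ren r h (⊢• p t s) with _ , _ , r₁ , r₂ , q ← ↪-split p r =
  ⊢• q (⊢ren r₁ h t) (⊢ren r₂ h s)
⊢ren r h (⊢▼ p t s) with _ , _ , r₁ , r₂ , q ← ↪-split p r =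
  ⊢▼ q (⊢ren r₁ h t) (⊢ren r₂ h s)
-- The body sees only its bound linear variable, so its relation restarts from `closed refl` instead
-- of extending `r`; likewise for `⊢▶`.
⊢ren r h (⊢! t) rewrite ↪-∅ r = ⊢! (⊢ren (lift₁ (closed refl)) h t)
⊢ren r h (⊢let! p s t) with _ , _ , r₁ , r₂ , q ← ↪-split p r =
  ⊢let! q (⊢ren r₁ h s) (⊢ren r₂ (lookup-lift h) t)
⊢ren r h (⊢⁇ t) = ⊢⁇ (⊢ren r (lookup-lift h) t)
⊢ren r h (⊢▶ s t) = ⊢▶ (⊢ren r h s) (⊢ren (lift₁ (closed refl)) h t)
⊢ren r h (⊢♯ p t s) with _ , _ , r₁ , r₂ , q ← ↪-split p r =
  ⊢♯ q (⊢ren r₁ h t) (⊢ren r₂ h s)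
⊢ren r h ⊢⋆ rewrite ↪-∅ r = ⊢⋆
⊢ren r h (⊢let⋆ p s t) with _ , _ , r₁ , r₂ , q ← ↪-split p r =
  ⊢let⋆ q (⊢ren r₁ h s) (⊢ren r₂ h t)

⊢renₗ : ∀ {l l′ u} {Δ : Vec Formula u} {A t} {ξ : Fin l → Fin l′} →
        Δ ⨾ ∅ ⊢ t ∶ A → Δ ⨾ ∅ ⊢ ren ξ id t ∶ A
⊢renₗ = ⊢ren (closed refl) (λ _ → refl)

infix 3 _⊢ₛ_∶_

-- The empty linear environment makes each `σ x` freely copyable and erasable, as an unrestricted
-- variable is.
_⊢ₛ_∶_ : ∀ {l u u′} → Vec Formula u′ → Subst l u u′ → Vec Formula u → Set
Δ′ ⊢ₛ σ ∶ Δ = ∀ x → Δ′ ⨾ ∅ ⊢ σ x ∶ lookup Δ x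

⊢liftᵤ : ∀ {l u u′ Δ Δ′ A} {σ : Subst l u u′} →
         Δ′ ⊢ₛ σ ∶ Δ → A ∷ Δ′ ⊢ₛ liftᵤ σ ∶ A ∷ Δ
⊢liftᵤ h zero    = ⊢uvar refl
⊢liftᵤ h (suc x) = ⊢ren (closed refl) (λ _ → refl) (h x)

-- An occurrence of `uvar` uses no linear variable and neither does its replacement, so `Γ` and
-- every split `p` stay unchanged.
⊢sub : ∀ {l u u′ Δ Δ′ Γ A t} {σ : Subst l u u′} →
       Δ′ ⊢ₛ σ ∶ Δ → Δ ⨾ Γ ⊢ t ∶ A → Δ′ ⨾ Γ ⊢ sub σ t ∶ A
⊢sub h ⊢lvar         = ⊢lvar
⊢sub h (⊢uvar refl)  = h _
⊢sub h (⊢⊗ p t s)    = ⊢⊗ p (⊢sub h t) (⊢sub h s)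
⊢sub h (⊢let⊗ p s t) = ⊢let⊗ p (⊢sub h s) (⊢sub (⊢renₗ ∘ h) t)
⊢sub h (⊢⅋ t)        = ⊢⅋ (⊢sub (⊢renₗ ∘ h) t)
⊢sub h (⊢• p t s)    = ⊢• p (⊢sub h t) (⊢sub h s)
⊢sub h (⊢▼ p t s)    = ⊢▼ p (⊢sub h t) (⊢sub h s)
⊢sub h (⊢! t)        = ⊢! (⊢sub (⊢renₗ ∘ h) t)
⊢sub h (⊢let! p s t) = ⊢let! p (⊢sub h s) (⊢sub (⊢liftᵤ h) t)
⊢sub h (⊢⁇ t)        = ⊢⁇ (⊢sub (⊢liftᵤ h) t)
⊢sub h (⊢▶ s t)      = ⊢▶ (⊢sub h s) (⊢sub (⊢renₗ ∘ h) t)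
⊢sub h (⊢♯ p t s)    = ⊢♯ p (⊢sub h t) (⊢sub h s)
⊢sub h ⊢⋆            = ⊢⋆
⊢sub h (⊢let⋆ p s t) = ⊢let⋆ p (⊢sub h s) (⊢sub h t)

⊢｛｝ : ∀ {l u} {Δ : Vec Formula u} {Γ : LEnv l} {A B t s} →
      B ∷ Δ ⨾ Γ ⊢ t ∶ A → Δ ⨾ ∅ ⊢ s ∶ B → Δ ⨾ Γ ⊢ t ｛ s ｝ ∶ A
⊢｛｝ t s = ⊢sub (λ { zero → s ; (suc x) → ⊢uvar refl }) t

⊢bang : ∀ {l u} {Δ : Vec Formula u} {A t} →
        Δ ⨾ ∅ {l} ⊢ t ∶ A → Δ ⨾ ∅ {l} ⊢ bang t ∶ ! A
⊢bang {A = A} t =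
  -- The bound variable has type `A ^⊥`, so `⊢!` produces `! (A ^⊥ ^⊥)`.
  ⊢-resp-≡ (cong !_ (^⊥-involutive A))
    (⊢! (⊢♯ (right ∅-split) (⊢renₗ t) ⊢lvar))

-- Generalising over `ρ`, `κ` and `k` lets the induction pass under binders: new unrestricted
-- variables go in front of `Δ`, and lookups past them compute, so `hρ` and `hκ` carry over.
⊢⟦⟧ : ∀ {n m l u A} {Γ : Vec Type n} {Σ : Vec Type m} {Δ : Vec Formula u} {M ρ κ k} →
      (∀ x → lookup Δ (ρ x) ≡ ⁇ (lookup Γ x ᵀ)) →
      (∀ γ → lookup Δ (κ γ) ≡ lookup Σ γ ᵀ ^⊥) →
      lookup Δ k ≡ A ᵀ ^⊥ →
      Γ ⊢ M ∶ A ∣ Σ → Δ ⨾ ∅ {l} ⊢ ⟦ M ⟧ ρ κ k ∶ ⊥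
⊢⟦⟧ hρ hκ hk (⊢var refl) = ⊢♯ ∅-split (⊢uvar (hρ _)) (⊢bang (⊢uvar hk))
⊢⟦⟧ hρ hκ hk (⊢ƛ {A = A} {B} M) =
  ⊢♯ ∅-split
    -- `a` and `b` get the two factors of `(A ⊃ B) ᵀ ^⊥`, so `⊢⅋` yields its dual, a double dual.
    (⊢-resp-≡ (^⊥-involutive ((A ⊃ B) ᵀ))
      -- The outer let takes `b` (index 0), giving `k′` the type `B ᵀ ^⊥`; the inner takes `a`
      -- (index 1), giving `x` the type `⁇ (A ᵀ ^⊥ ^⊥)`.
      (⊢⅋ (⊢let! (left (right ∅-split)) ⊢lvar
        (⊢let! (none (left ∅-split)) ⊢lvar
          (⊢⟦⟧ (λ { zero → cong ⁇_ (^⊥-involutive (A ᵀ))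
                  ; (suc x) → hρ x })
               hκ refl M)))))
    (⊢uvar hk)
⊢⟦⟧ hρ hκ hk (⊢· {A = A} M N) =
  ⊢｛｝ (⊢⟦⟧ hρ hκ refl M)
    (⊢⊗ ∅-split
      -- The first factor of the type of `k′` is `! (⁇ (A ᵀ ^⊥ ^⊥))`, while `⊢bang` gives
      -- `! (⁇ (A ᵀ))`.
      (⊢-resp-≡ (cong (!_ ∘ ⁇_) (sym (^⊥-involutive (A ᵀ))))
        (⊢bang (⊢⁇ (⊢⟦⟧ hρ hκ refl N))))
      (⊢bang (⊢uvar hk)))
⊢⟦⟧ hρ hκ hk (⊢named {γ = γ} refl M) =
  -- `k` has type `⊥ ᵀ ^⊥`, that is `𝟙`, the dual of the left side's `⊥`.
  ⊢♯ ∅-split (⊢｛｝ (⊢⟦⟧ hρ hκ refl M) (⊢uvar (hκ γ))) (⊢uvar hk)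
⊢⟦⟧ hρ hκ hk (⊢μ M) =
  -- `k′` has type `𝟙`, inhabited by `⋆`; `γ` and `k` share the type `A ᵀ ^⊥`.
  ⊢｛｝ (⊢｛｝ (⊢⟦⟧ hρ (λ { zero → refl ; (suc γ) → hκ γ }) refl M) ⊢⋆) (⊢uvar hk)

lemma20 : ∀ {n m l : ℕ} {Γ : Vec Type n} {Σ : Vec Type m} {M : Tm n m} {A : Type} →
    Γ ⊢ M ∶ A ∣ Σ →
    A ᵀ ^⊥ ∷ (⁇ Γ ᵀ* ++ Σ ᵀ*^⊥) ⨾ ∅ {l} ⊢ translate M ∶ ⊥
lemma20 {Γ = Γ} {Σ} =
  ⊢⟦⟧ (λ x → trans (lookup-++ˡ (⁇ Γ ᵀ*) (Σ ᵀ*^⊥) x) (lookup-map x _ Γ))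
      (λ γ → trans (lookup-++ʳ (⁇ Γ ᵀ*) (Σ ᵀ*^⊥) γ) (lookup-map γ _ Σ))
      refl
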